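{- Let $G$ be an arbitrary connected cubic graph, let $H$ be a connected $2$-chromatic cubic graph (i.e. $H \in Q_2$), and let $l \geq 1$ be an integer. Then $\chi_=(G \circ^l H) \leq 4$.
   Context: All graphs are finite and simple. A cubic graph is a $3$-regular graph; $Q_2$ denotes the class of connected cubic graphs with chromatic number $2$. A graph $F$ is equitably $k$-colorable if $V(F)$ can be partitioned into $k$ (possibly empty) independent sets $V_1,\dots,V_k$ with $\bigl||V_i|-|V_j|\bigr|\le 1$ for all $i,j$. The equitable chromatic number $\chi_=(F)$ is the smallest integer $k$ such that $F$ is equitably $k$-colorable. The corona $G\circ H$ of graphs $G$ and $H$ is formed from one copy of $G$ and $|V(G)|$ disjoint copies of $H$ by joining the $i$-th vertex of $G$ to every vertex of the $i$-th copy of $H$. The $l$-corona product is defined by $G\circ^1 H = G\circ H$ and $G\circ^l H = (G\circ^{l-1}H)\circ H$ for $l\ge 2$. -}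

module Defs where

open import Data.Fin using (Fin)
import Data.Fin.Properties as Fin
open import Data.List using (List; _++_; map; filter; length; cartesianProduct)
open import Data.List.Membership.Propositional using (_∈_)
open import Data.List.Membership.Propositional.Properties
  using (∈-map⁺; ∈-map⁻; ∈-++⁺ˡ; ∈-++⁺ʳ; ∈-cartesianProduct⁺)
open import Data.List.Relation.Unary.Unique.Propositional using (Unique)
import Data.List.Relation.Unary.Unique.Propositional.Properties as Unique
open import Data.Nat using (ℕ; zero; suc; _≤_; ∣_-_∣)
open import Data.Product using (_×_; _,_; Σ)
open import Data.Product.Properties using () renaming (≡-dec to ×-≡-dec)
open import Data.Sum using (_⊎_; inj₁; inj₂)
open import Data.Sum.Properties using (inj₁-injective; inj₂-injective)
  renaming (≡-dec to ⊎-≡-dec)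
open import Relation.Binary using (Decidable; DecidableEquality; Symmetric)
open import Relation.Binary.Construct.Closure.ReflexiveTransitive using (Star)
open import Relation.Binary.PropositionalEquality using (_≡_; _≢_; refl)
open import Relation.Nullary using (¬_; yes; no)
open import Relation.Nullary.Decidable using (map′)

-- Finiteness is witnessed by a duplicate-free list of all vertices.  Vertex
-- equality and adjacency are decidable, as is automatic classically.
record Graph : Set₁ where
  field
    V        : Set
    _≟_      : DecidableEquality V
    vertices : List V
    unique   : Unique vertices
    complete : ∀ v → v ∈ vertices
    Adj      : V → V → Set
    adj?     : Decidable Adj
    adj-sym  : Symmetric Adj
    loopless : ∀ {v} → ¬ Adj v v

open Graph using (V)

degree : (G : Graph) → V G → ℕ
degree G v = length (filter (adj? v) vertices)
  where open Graph G

Cubic : Graph → Set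
Cubic G = ∀ v → degree G v ≡ 3

-- The graph without vertices is not connected.
Connected : Graph → Set
Connected G = V G × (∀ u v → Star (Graph.Adj G) u v)

-- A partition into k possibly empty independent sets V₁,…,Vₖ is given by the
-- map c sending each vertex to the index of its part.
Proper : (G : Graph) {k : ℕ} → (V G → Fin k) → Set
Proper G c = ∀ {u v} → Graph.Adj G u v → c u ≢ c v

classSize : (G : Graph) {k : ℕ} → (V G → Fin k) → Fin k → ℕ
classSize G c i = length (filter (λ v → c v Fin.≟ i) (Graph.vertices G))

Colorable : Graph → ℕ → Set
Colorable G k = Σ (V G → Fin k) (Proper G)

EquitablyColorable : Graph → ℕ → Set
EquitablyColorable G k = Σ (V G → Fin k) λ c →
  Proper G c × (∀ i j → ∣ classSize G c i - classSize G c j ∣ ≤ 1)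

IsLeast : (ℕ → Set) → ℕ → Set
IsLeast P k = P k × (∀ j → P j → k ≤ j)

IsChromaticNumber : Graph → ℕ → Set
IsChromaticNumber G = IsLeast (Colorable G)

IsEquitableChromaticNumber : Graph → ℕ → Set
IsEquitableChromaticNumber G = IsLeast (EquitablyColorable G)

Q₂ : Graph → Set
Q₂ H = Connected H × Cubic H × IsChromaticNumber H 2

module Corona (G H : Graph) where
  private
    module G = Graph G
    module H = Graph H

  -- inj₂ (u , x) is the vertex x in the copy of H attached to u.
  CV : Set
  CV = G.V ⊎ (G.V × H.V)

  data CAdj : CV → CV → Set where
    base  : ∀ {u v} → G.Adj u v → CAdj (inj₁ u) (inj₁ v)
    copy  : ∀ {u x y} → H.Adj x y → CAdj (inj₂ (u , x)) (inj₂ (u , y))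
    joinˡ : ∀ {u x} → CAdj (inj₁ u) (inj₂ (u , x))
    joinʳ : ∀ {u x} → CAdj (inj₂ (u , x)) (inj₁ u)

  cadj? : Decidable CAdj
  cadj? (inj₁ u) (inj₁ v) = map′ base (λ { (base a) → a }) (G.adj? u v)
  cadj? (inj₁ u) (inj₂ (v , x)) =
    map′ (λ { refl → joinˡ }) (λ { joinˡ → refl }) (u G.≟ v)
  cadj? (inj₂ (v , x)) (inj₁ u) =
    map′ (λ { refl → joinʳ }) (λ { joinʳ → refl }) (v G.≟ u)
  cadj? (inj₂ (u , x)) (inj₂ (v , y)) with u G.≟ v
  ... | yes refl = map′ copy (λ { (copy a) → a }) (H.adj? x y)
  ... | no u≢v   = no λ { (copy _) → u≢v refl }

  cadj-sym : Symmetric CAdj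
  cadj-sym (base a) = base (G.adj-sym a)
  cadj-sym (copy a) = copy (H.adj-sym a)
  cadj-sym joinˡ    = joinʳ
  cadj-sym joinʳ    = joinˡ

  cloopless : ∀ {v} → ¬ CAdj v v
  cloopless (base a) = G.loopless a
  cloopless (copy a) = H.loopless a

  cvertices : List CV
  cvertices = map inj₁ G.vertices ++ map inj₂ (cartesianProduct G.vertices H.vertices)

  cunique : Unique cvertices
  cunique = Unique.++⁺
    (Unique.map⁺ inj₁-injective G.unique)
    (Unique.map⁺ inj₂-injective (Unique.cartesianProduct⁺ G.unique H.unique))
    disjoint
    where
    disjoint : ∀ {v} → ¬ (v ∈ map inj₁ G.vertices ×
                          v ∈ map inj₂ (cartesianProduct G.vertices H.vertices))
    disjoint (p , q) with ∈-map⁻ inj₁ p | ∈-map⁻ inj₂ q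
    ... | _ , _ , refl | _ , _ , ()

  ccomplete : ∀ v → v ∈ cvertices
  ccomplete (inj₁ u)       = ∈-++⁺ˡ (∈-map⁺ inj₁ (G.complete u))
  ccomplete (inj₂ (u , x)) = ∈-++⁺ʳ (map inj₁ G.vertices)
    (∈-map⁺ inj₂ (∈-cartesianProduct⁺ (G.complete u) (H.complete x)))

  corona : Graph
  corona = record
    { V        = CV
    ; _≟_      = ⊎-≡-dec G._≟_ (×-≡-dec G._≟_ H._≟_)
    ; vertices = cvertices
    ; unique   = cunique
    ; complete = ccomplete
    ; Adj      = CAdj
    ; adj?     = cadj?
    ; adj-sym  = cadj-sym
    ; loopless = cloopless
    }

infixl 7 _⊚_ _⊚^[_]_

_⊚_ : Graph → Graph → Graph
G ⊚ H = Corona.corona G H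

-- The l-corona product; starting the recursion at G ⊚^[ 0 ] H = G gives
-- G ⊚^[ 1 ] H = G ⊚ H.
_⊚^[_]_ : Graph → ℕ → Graph → Graph
G ⊚^[ zero ] H  = G
G ⊚^[ suc l ] H = (G ⊚^[ l ] H) ⊚ H

{-# OPTIONS --safe #-}
module Submission where

-- A proper 4-colouring is carried along together with a perfect pairing of the vertices into pairs
-- of different colours.  In a cubic graph take a maximal matching, pair the evenly many unmatched
-- vertices arbitrarily, colour them 0 and 1, and finish greedily.  In a corona, F keeps its pairs
-- and each copy of H is paired across its bipartition, whose sides have equal size m.
--
-- A copy of H is coloured with one colour on one side, and one colour on the other side except
-- possibly at a single vertex.  For a pair u, v of different colours, the two copies can be coloured
-- so that u, v and both copies contain every colour m times, plus once more for any prescribed two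
-- colours.  Alternating complementary prescriptions along the pairs keeps the classes balanced.
--
-- Equitable colourability is decidable, so the least number of colours exists and is at most 4.

open import Defs
open import Data.Bool using (if_then_else_; true; false)
open import Data.Fin using (Fin; zero; suc; _≟_; funToFin; finToFun)
open import Data.Fin.Properties using (any?; all?; finToFun-funToFin)
open import Data.List
  using (List; []; _∷_; _++_; map; filter; length; zip; take; drop; cartesianProduct; lookup)
open import Data.List.Membership.Propositional using (_∈_; _∉_; find)
open import Data.List.Membership.Propositional.Properties
  using (∈-∃++; ∈-++⁺ˡ; ∈-++⁺ʳ; ∈-filter⁺; ∈-filter⁻)
import Data.List.Membership.DecPropositional as DecMembership
open import Data.List.Properties
  using (length-++; length-take; length-drop; length-map; take++drop≡id; map-++; map-∘)
open import Data.List.Relation.Binary.Permutation.Propositional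
  using (_↭_; ↭-refl; ↭-sym; ↭-trans; ↭-prep; ↭-reflexive; ↭⇒↭ₛ; module PermutationReasoning)
open import Data.List.Relation.Binary.Permutation.Propositional.Properties
  using (shift; ++-comm; ++⁺; ++⁺ˡ; map⁺; ↭-length; ∈-resp-↭)
import Data.List.Relation.Binary.Permutation.Setoid.Properties as Permutation
open import Data.List.Relation.Unary.All as All using (All; []; _∷_)
import Data.List.Relation.Unary.All.Properties as All
open import Data.List.Relation.Unary.AllPairs using ([]; _∷_)
import Data.List.Relation.Unary.AllPairs as AllPairs
open import Data.List.Relation.Unary.Any as Any using (here; there)
open import Data.List.Relation.Unary.Any.Properties using (lookup-index)
open import Data.List.Relation.Unary.Unique.Propositional using (Unique)
import Data.List.Relation.Unary.Unique.Propositional.Properties as Unique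
open import Data.Nat using (ℕ; zero; suc; _+_; _*_; _≤_; z≤n; s≤s; ∣_-_∣)
import Data.Nat as ℕ
open import Data.Nat.Divisibility using (_∣_; divides; ∣m∣n⇒∣m+n; ∣m+n∣m⇒∣n; n∣m*n)
open import Data.Nat.ListAction using (sum)
open import Data.Nat.ListAction.Properties using (sum-++; sum-↭)
import Data.Nat.Properties as ℕ
open import Data.Nat.Solver using (module +-*-Solver)
open import Data.Product using (∃; ∃₂; _×_; _,_; proj₁; proj₂)
open import Data.Sum using (inj₁; inj₂)
open import Data.Unit using (tt)
open import Function using (_∘_)
open import Relation.Binary using (DecidableEquality)
open import Relation.Binary.PropositionalEquality
  using (_≡_; _≢_; refl; sym; trans; cong; cong₂; subst; ≢-sym; setoid; module ≡-Reasoning)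
open import Relation.Nullary using (Dec; yes; no; does; ¬_; contradiction)
open import Relation.Nullary.Decidable
  using (_×-dec_; _→-dec_; ¬?; toWitness; map′; dec-true; dec-false)
open import Relation.Unary using (Decidable)

open +-*-Solver using (solve; _:+_; _:*_; _:=_; con)

-- Indicators of decidable propositions.

𝟙 : {P : Set} → Dec P → ℕ
𝟙 d = if does d then 1 else 0

𝟙-cong : {P Q : Set} (p : Dec P) (q : Dec Q) → (P → Q) → (Q → P) → 𝟙 p ≡ 𝟙 q
𝟙-cong (yes _) (yes _) _ _ = refl
𝟙-cong (no _)  (no _)  _ _ = refl
𝟙-cong (yes p) (no ¬q) f _ = contradiction (f p) ¬q
𝟙-cong (no ¬p) (yes q) _ g = contradiction (g q) ¬p

𝟙-no : {P : Set} (p : Dec P) → ¬ P → 𝟙 p ≡ 0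
𝟙-no p ¬p rewrite dec-false p ¬p = refl

-- Sums over lists

module _ {A : Set} where

  ∑ : List A → (A → ℕ) → ℕ
  ∑ xs f = sum (map f xs)

  ∑-cong : ∀ xs {f g : A → ℕ} → (∀ {x} → x ∈ xs → f x ≡ g x) → ∑ xs f ≡ ∑ xs g
  ∑-cong []       f≡g = refl
  ∑-cong (x ∷ xs) f≡g = cong₂ _+_ (f≡g (here refl)) (∑-cong xs (f≡g ∘ there))

  ∑-const : ∀ xs k → ∑ xs (λ _ → k) ≡ length xs * k
  ∑-const []       k = refl
  ∑-const (x ∷ xs) k = cong (k +_) (∑-const xs k)

  ∑-++ : ∀ xs ys (f : A → ℕ) → ∑ (xs ++ ys) f ≡ ∑ xs f + ∑ ys f
  ∑-++ xs ys f = trans (cong sum (map-++ f xs ys)) (sum-++ (map f xs) (map f ys))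

  ∑-↭ : ∀ {xs ys} → xs ↭ ys → (f : A → ℕ) → ∑ xs f ≡ ∑ ys f
  ∑-↭ xs↭ys f = sum-↭ (map⁺ f xs↭ys)

  ∑-+ : ∀ xs (f g : A → ℕ) → ∑ xs (λ x → f x + g x) ≡ ∑ xs f + ∑ xs g
  ∑-+ []       f g = refl
  ∑-+ (x ∷ xs) f g = trans (cong (f x + g x +_) (∑-+ xs f g))
    (solve 4 (λ a b c d → a :+ b :+ (c :+ d) := a :+ c :+ (b :+ d)) refl (f x) (g x) _ _)

  length-filter-∑ : {P : A → Set} (P? : Decidable P) → ∀ xs →
                    length (filter P? xs) ≡ ∑ xs (𝟙 ∘ P?)
  length-filter-∑ P? []       = refl
  length-filter-∑ P? (x ∷ xs) with does (P? x)
  ... | true  = cong suc (length-filter-∑ P? xs)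
  ... | false = length-filter-∑ P? xs

  -- Removing the head removes its row and its column, which have equal sums by symmetry, while the
  -- diagonal entry vanishes. This is the parity half of the handshake argument.
  ∑-symmetric-even : (f : A → A → ℕ) → (∀ x → f x x ≡ 0) → (∀ x y → f x y ≡ f y x) →
                     ∀ xs → 2 ∣ ∑ xs (λ x → ∑ xs (f x))
  ∑-symmetric-even f f-diag f-sym []       = divides 0 refl
  ∑-symmetric-even f f-diag f-sym (x ∷ xs) = subst (2 ∣_) (sym split)
    (∣m∣n⇒∣m+n (n∣m*n (∑ xs (f x))) (∑-symmetric-even f f-diag f-sym xs))
    where
    open ≡-Reasoning
    E = ∑ xs (λ y → ∑ xs (f y))
    split : ∑ (x ∷ xs) (λ y → ∑ (x ∷ xs) (f y)) ≡ ∑ xs (f x) * 2 + E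
    split = begin
      f x x + ∑ xs (f x) + ∑ xs (λ y → f y x + ∑ xs (f y))
        ≡⟨ cong₂ (λ a b → a + ∑ xs (f x) + b) (f-diag x) (∑-+ xs (λ y → f y x) _) ⟩
      ∑ xs (f x) + (∑ xs (λ y → f y x) + E)
        ≡⟨ cong (λ a → ∑ xs (f x) + (a + E)) (∑-cong xs (λ {y} _ → f-sym y x)) ⟩
      ∑ xs (f x) + (∑ xs (f x) + E)
        ≡⟨ solve 2 (λ s e → s :+ (s :+ e) := s :* con 2 :+ e) refl (∑ xs (f x)) E ⟩
      ∑ xs (f x) * 2 + E ∎

∑-map : {A B : Set} (g : A → B) (f : B → ℕ) → ∀ xs → ∑ (map g xs) f ≡ ∑ xs (f ∘ g)
∑-map g f xs = cong sum (sym (map-∘ xs))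

∑-swap : {A B : Set} (f : A → B → ℕ) → ∀ xs ys →
         ∑ xs (λ x → ∑ ys (f x)) ≡ ∑ ys (λ y → ∑ xs (λ x → f x y))
∑-swap f []       ys = sym (trans (∑-const ys 0) (ℕ.*-zeroʳ (length ys)))
∑-swap f (x ∷ xs) ys = trans (cong (∑ ys (f x) +_) (∑-swap f xs ys)) (sym (∑-+ ys (f x) _))

∑-cartesianProduct : {A B : Set} (f : A × B → ℕ) → ∀ xs ys →
  ∑ (cartesianProduct xs ys) f ≡ ∑ xs (λ x → ∑ ys (λ y → f (x , y)))
∑-cartesianProduct f []       ys = refl
∑-cartesianProduct f (x ∷ xs) ys = trans (∑-++ (map (x ,_) ys) _ f)
  (cong₂ _+_ (∑-map (x ,_) f ys) (∑-cartesianProduct f xs ys))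

-- Lists and pairings

module _ {A : Set} where

  flatten : List (A × A) → List A
  flatten []             = []
  flatten ((a , b) ∷ ps) = a ∷ b ∷ flatten ps

  flatten-++ : ∀ ps qs → flatten (ps ++ qs) ≡ flatten ps ++ flatten qs
  flatten-++ []             qs = refl
  flatten-++ ((a , b) ∷ ps) qs = cong (λ xs → a ∷ b ∷ xs) (flatten-++ ps qs)

  length-flatten : ∀ ps → length (flatten ps) ≡ length ps * 2
  length-flatten []       = refl
  length-flatten (_ ∷ ps) = cong (2 +_) (length-flatten ps)

  flatten-zip : ∀ xs ys → length xs ≡ length ys → flatten (zip xs ys) ↭ xs ++ ys
  flatten-zip []       []       _  = ↭-refl
  flatten-zip (x ∷ xs) (y ∷ ys) eq = ↭-prep x
    (↭-trans (↭-prep y (flatten-zip xs ys (ℕ.suc-injective eq))) (↭-sym (shift y xs ys)))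

  length-zip : ∀ (xs ys : List A) → length xs ≡ length ys → length (zip xs ys) ≡ length xs
  length-zip []       []       _  = refl
  length-zip (x ∷ xs) (y ∷ ys) eq = cong suc (length-zip xs ys (ℕ.suc-injective eq))

  All-zip : {P Q : A → Set} → ∀ {xs ys} → All P xs → All Q ys →
            All (λ (a , b) → P a × Q b) (zip xs ys)
  All-zip []         _          = []
  All-zip (px ∷ pxs) []         = []
  All-zip (px ∷ pxs) (qy ∷ qys) = (px , qy) ∷ All-zip pxs qys

  ∑-flatten : ∀ {ps : List (A × A)} {f : A → ℕ} {k} → All (λ (a , b) → f a + f b ≡ k) ps →
              ∑ (flatten ps) f ≡ length ps * k
  ∑-flatten {[]} []    = refl
  ∑-flatten {(a , b) ∷ _} {f} (eq ∷ eqs) =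
    trans (sym (ℕ.+-assoc (f a) (f b) _)) (cong₂ _+_ eq (∑-flatten eqs))

  ∈⇒↭ : ∀ {x : A} {xs} → x ∈ xs → ∃ λ ys → xs ↭ x ∷ ys
  ∈⇒↭ x∈xs with ∈-∃++ x∈xs
  ... | as , bs , refl = as ++ bs , shift _ as bs

  filter-split : {P : A → Set} (P? : Decidable P) → ∀ xs →
                 filter P? xs ++ filter (¬? ∘ P?) xs ↭ xs
  filter-split P? []       = ↭-refl
  filter-split P? (x ∷ xs) with does (P? x)
  ... | true  = ↭-prep x (filter-split P? xs)
  ... | false = ↭-trans (shift x (filter P? xs) _) (↭-prep x (filter-split P? xs))

  Unique-resp-↭ : ∀ {xs ys : List A} → xs ↭ ys → Unique xs → Unique ys
  Unique-resp-↭ = Permutation.Unique-resp-↭ (setoid A) ∘ ↭⇒↭ₛ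

  ++-disjoint : ∀ xs {ys} → Unique (xs ++ ys) → ∀ {x : A} → x ∈ xs → x ∉ ys
  ++-disjoint (x ∷ xs) (x∉ ∷ _) (here refl) x∈ys = All.lookup x∉ (∈-++⁺ʳ xs x∈ys) refl
  ++-disjoint (x ∷ xs) (_ ∷ u)  (there x∈)  x∈ys = ++-disjoint xs u x∈ x∈ys

++-uniqueʳ : {A : Set} → ∀ xs {ys : List A} → Unique (xs ++ ys) → Unique ys
++-uniqueʳ []       u       = u
++-uniqueʳ (_ ∷ xs) (_ ∷ u) = ++-uniqueʳ xs u

flatten-map : {A B : Set} (g : A → B) → ∀ ps →
              flatten (map (λ (a , b) → g a , g b) ps) ≡ map g (flatten ps)
flatten-map g []             = refl
flatten-map g ((a , b) ∷ ps) = cong (λ xs → g a ∷ g b ∷ xs) (flatten-map g ps)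

-- The order of the pairs is chosen so that flattening gives `cartesianProduct` as an equality of
-- lists, not merely up to permutation.
copy-pairs : {A B : Set} → List A → List (B × B) → List ((A × B) × (A × B))
copy-pairs []       ps = []
copy-pairs (u ∷ us) ps = map (λ (a , b) → (u , a) , (u , b)) ps ++ copy-pairs us ps

flatten-copy-pairs : {A B : Set} (us : List A) (ps : List (B × B)) →
                     flatten (copy-pairs us ps) ≡ cartesianProduct us (flatten ps)
flatten-copy-pairs []       ps = refl
flatten-copy-pairs (u ∷ us) ps = trans (flatten-++ (map _ ps) (copy-pairs us ps))
  (cong₂ _++_ (flatten-map (u ,_) ps) (flatten-copy-pairs us ps))

All-copy-pairs : {A B : Set} {R : (A × B) × (A × B) → Set} → ∀ us {ps} →
                 All (λ (a , b) → ∀ u → R ((u , a) , (u , b))) ps → All R (copy-pairs us ps)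
All-copy-pairs []       Rps = []
All-copy-pairs (u ∷ us) Rps =
  All.++⁺ (All.map⁺ (All.map (λ Rab → Rab u) Rps)) (All-copy-pairs us Rps)

cartesianProduct-↭ʳ : {A B : Set} (us : List A) {xs ys : List B} → xs ↭ ys →
                      cartesianProduct us xs ↭ cartesianProduct us ys
cartesianProduct-↭ʳ []       xs↭ys = ↭-refl
cartesianProduct-↭ʳ (u ∷ us) xs↭ys = ++⁺ (map⁺ (u ,_) xs↭ys) (cartesianProduct-↭ʳ us xs↭ys)

-- The family `T` is dependent because the type of a palette mentions the colour of its vertex; a
-- constant family covers plain colourings.
module Update {A : Set} (_≟ᴬ_ : DecidableEquality A) {T : A → Set} (f : ∀ x → T x) where

  update : ∀ x → T x → ∀ y → T y
  update x t y with x ≟ᴬ y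
  ... | yes refl = t
  ... | no _     = f y

  update-≡ : ∀ x t → update x t x ≡ t
  update-≡ x t with x ≟ᴬ x
  ... | yes refl = refl
  ... | no x≢x   = contradiction refl x≢x

  update-≢ : ∀ {x y} t → x ≢ y → update x t y ≡ f y
  update-≢ {x} {y} t x≢y with x ≟ᴬ y
  ... | yes x≡y = contradiction x≡y x≢y
  ... | no _    = refl

-- Finite facts about four colours.

Color : Set
Color = Fin 4

δ : Color → Color → ℕ
δ a i = 𝟙 (a ≟ i)

-- Here x and y are the colours of two paired vertices; α, β, γ serve the copy at the first and α′,
-- β′, γ′ the copy at the second. By the first sum α, γ, α′, γ′ are all four colours, which forces y
-- into {α, γ} and x into {α′, γ′}. In the second sum the six leftover vertices together with a and
-- b use every colour twice. As β shares a side with α, these two may coincide. Choosing β and β′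
-- last keeps the exhaustive search small.
PalettePair : Color → Color → Color → Color → Set
PalettePair x y a b =
  ∃₂ λ α γ → ∃₂ λ α′ γ′ → (α ≢ x × γ ≢ x × α′ ≢ y × γ′ ≢ y × α ≢ γ × α′ ≢ γ′)
    × (∀ i → δ α i + δ γ i + (δ α′ i + δ γ′ i) ≡ 1) ×
    ∃₂ λ β β′ → (β ≢ x × β ≢ γ × β′ ≢ y × β′ ≢ γ′)
    × ∀ i → (δ x i + δ β i + δ γ i) + (δ y i + δ β′ i + δ γ′ i) + (δ a i + δ b i) ≡ 2

-- All three facts are settled by running a decision procedure over all colours; their witnesses are
-- never unfolded afterwards.
abstract

  complementary-pair : ∀ a b → a ≢ b →
    ∃₂ λ x y → x ≢ y × (∀ i → δ a i + δ b i + (δ x i + δ y i) ≡ 1)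
  complementary-pair = toWitness {a? = all? λ a → all? λ b → ¬? (a ≟ b) →-dec
    any? λ x → any? λ y → ¬? (x ≟ y) ×-dec all? λ i → _ ℕ.≟ _} tt

  palette-pair : ∀ x y a b → x ≢ y → a ≢ b → PalettePair x y a b
  palette-pair = toWitness {a? = all? λ x → all? λ y → all? λ a → all? λ b →
    ¬? (x ≟ y) →-dec ¬? (a ≟ b) →-dec
    any? λ α → any? λ γ → any? λ α′ → any? λ γ′ →
    (¬? (α ≟ x) ×-dec ¬? (γ ≟ x) ×-dec ¬? (α′ ≟ y) ×-dec ¬? (γ′ ≟ y) ×-dec
     ¬? (α ≟ γ) ×-dec ¬? (α′ ≟ γ′)) ×-dec
    (all? λ i → _ ℕ.≟ _) ×-dec
    any? λ β → any? λ β′ →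
    (¬? (β ≟ x) ×-dec ¬? (β ≟ γ) ×-dec ¬? (β′ ≟ y) ×-dec ¬? (β′ ≟ γ′)) ×-dec
    all? λ i → _ ℕ.≟ _} tt

  free-color : ∀ a b c → ∃ λ (k : Color) → k ≢ a × k ≢ b × k ≢ c
  free-color = toWitness {a? = all? λ a → all? λ b → all? λ c → any? λ k →
    ¬? (k ≟ a) ×-dec ¬? (k ≟ b) ×-dec ¬? (k ≟ c)} tt

free-color-list : ∀ cs → length cs ≡ 3 → ∃ λ (k : Color) → All (k ≢_) cs
free-color-list (a ∷ b ∷ c ∷ []) refl =
  let k , k≢a , k≢b , k≢c = free-color a b c in k , k≢a ∷ k≢b ∷ k≢c ∷ []

-- No balance is asked of `color`: a corona step keeps the colours of the old vertices and evens out
-- the class sizes by means of the new copies alone.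
record PairedColoring (F : Graph) : Set where
  open Graph F
  field
    color       : V → Color
    proper      : Proper F color
    pairs       : List (V × V)
    covers      : flatten pairs ↭ vertices
    bichromatic : All (λ (u , v) → color u ≢ color v) pairs

-- Cubic graphs: double counting, matchings and greedy colouring.

module CubicGraph (G : Graph) (cubic : Cubic G) where
  open Graph G renaming (_≟_ to _≟ⱽ_)
  open DecMembership _≟ⱽ_ using (_∈?_)
  open Update _≟ⱽ_ {λ _ → Color}

  Independent : List V → Set
  Independent xs = ∀ {u v} → u ∈ xs → v ∈ xs → ¬ Adj u v

  edge : V → V → ℕ
  edge u v = 𝟙 (adj? u v)

  edge-sym : ∀ u v → edge u v ≡ edge v u
  edge-sym u v = 𝟙-cong (adj? u v) (adj? v u) adj-sym adj-sym

  ∑-edge : ∀ v → ∑ vertices (edge v) ≡ 3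
  ∑-edge v = trans (sym (length-filter-∑ (adj? v) vertices)) (cubic v)

  -- The degree sum 3n is even by symmetry of adjacency, and 3n = 2n + n.
  2∣∣V∣ : 2 ∣ length vertices
  2∣∣V∣ = ∣m+n∣m⇒∣n (subst (2 ∣_) handshake even) (n∣m*n (length vertices))
    where
    even : 2 ∣ ∑ vertices (λ v → ∑ vertices (edge v))
    even = ∑-symmetric-even edge (λ v → 𝟙-no (adj? v v) loopless) edge-sym vertices
    handshake : ∑ vertices (λ v → ∑ vertices (edge v)) ≡ length vertices * 2 + length vertices
    handshake = trans (∑-cong vertices (λ {v} _ → ∑-edge v)) (trans (∑-const vertices 3)
      (solve 1 (λ n → n :* con 3 := n :* con 2 :+ n) refl (length vertices)))

  -- A vertex of the independent part S has no neighbour in S, so all three of its edges end in T.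
  ∑-edge-across : ∀ {S T} → S ++ T ↭ vertices → Independent S →
                  ∑ S (λ u → ∑ T (edge u)) ≡ length S * 3
  ∑-edge-across {S} {T} S++T↭V indep = trans (∑-cong S edges-to-T) (∑-const S 3)
    where
    open ≡-Reasoning
    edges-to-T : ∀ {u} → u ∈ S → ∑ T (edge u) ≡ 3
    edges-to-T {u} u∈S = begin
      ∑ T (edge u)
        ≡⟨ cong (_+ ∑ T (edge u)) (trans (∑-const S 0) (ℕ.*-zeroʳ (length S))) ⟨
      ∑ S (λ _ → 0) + ∑ T (edge u)
        ≡⟨ cong (_+ ∑ T (edge u)) (∑-cong S (λ {v} v∈S → 𝟙-no (adj? u v) (indep u∈S v∈S))) ⟨
      ∑ S (edge u) + ∑ T (edge u)  ≡⟨ ∑-++ S T (edge u) ⟨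
      ∑ (S ++ T) (edge u)          ≡⟨ ∑-↭ S++T↭V (edge u) ⟩
      ∑ vertices (edge u)          ≡⟨ ∑-edge u ⟩
      3                            ∎

  -- Counting the edges between the parts from either side gives three times the size of that side.
  bipartition-balanced : ∀ {S T} → S ++ T ↭ vertices → Independent S → Independent T →
                         length S ≡ length T
  bipartition-balanced {S} {T} S++T↭V indepS indepT = ℕ.*-cancelʳ-≡ (length S) (length T) 3 (begin
    length S * 3                        ≡⟨ ∑-edge-across S++T↭V indepS ⟨
    ∑ S (λ u → ∑ T (edge u))            ≡⟨ ∑-swap edge S T ⟩
    ∑ T (λ v → ∑ S (λ u → edge u v))    ≡⟨ ∑-cong T (λ {v} _ → ∑-cong S λ {u} _ → edge-sym u v) ⟩
    ∑ T (λ v → ∑ S (edge v))            ≡⟨ ∑-edge-across (↭-trans (++-comm T S) S++T↭V) indepT ⟩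
    length T * 3                        ∎)
    where open ≡-Reasoning

  -- Each new vertex is either matched to an unmatched neighbour or, having none, joins the
  -- independent remainder. Independence of the remainder is maximality.
  maximal-matching : ∀ xs → ∃₂ λ ps is →
    flatten ps ++ is ↭ xs × All (λ (u , v) → Adj u v) ps × Independent is
  maximal-matching []       = [] , [] , ↭-refl , [] , λ ()
  maximal-matching (x ∷ xs) with maximal-matching xs
  ... | ps , is , covers , matched , indep with Any.any? (adj? x) is
  ...   | yes x~is =
    let w , w∈is , x~w = find x~is
        js , is↭w∷js = ∈⇒↭ w∈is
        inclusion : ∀ {v} → v ∈ js → v ∈ is
        inclusion v∈js = ∈-resp-↭ (↭-sym is↭w∷js) (there v∈js)
    in (x , w) ∷ ps , js ,
       ↭-prep x (↭-trans (↭-sym (shift w (flatten ps) js))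
                (↭-trans (++⁺ˡ (flatten ps) (↭-sym is↭w∷js)) covers)) ,
       x~w ∷ matched ,
       λ u∈js v∈js → indep (inclusion u∈js) (inclusion v∈js)
  ...   | no x≁is = ps , x ∷ is , ↭-trans (shift x (flatten ps) is) (↭-prep x covers) , matched ,
    λ { (here refl) (here refl) → loopless
      ; (here refl) (there v∈)  → λ x~v → x≁is (Any.map (λ { refl → x~v }) v∈)
      ; (there u∈)  (here refl) → λ u~x → x≁is (Any.map (λ { refl → adj-sym u~x }) u∈)
      ; (there u∈)  (there v∈)  → indep u∈ v∈ }

  ProperOn : List V → (V → Color) → Set
  ProperOn L c = ∀ {u v} → u ∈ L → v ∈ L → Adj u v → c u ≢ c v

  Extends : List V → (V → Color) → (V → Color) → Set
  Extends L c c′ = ∀ {u} → u ∈ L → c′ u ≡ c u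

  -- A new vertex has exactly three neighbours, so some colour avoids the values of `c` on all of
  -- them, including those outside `L`. A vertex already in `L` keeps its colour; the greedy run
  -- over all `vertices` therefore respects the colours fixed in advance.
  extend-coloring : ∀ {L} c v → ProperOn L c → ∃ λ c′ → Extends L c c′ × ProperOn (v ∷ L) c′
  extend-coloring {L} c v proper with v ∈? L
  ... | yes v∈L = c , (λ _ → refl) , λ u∈ w∈ → proper (known u∈) (known w∈)
    where
    known : ∀ {u} → u ∈ v ∷ L → u ∈ L
    known (here refl) = v∈L
    known (there u∈L) = u∈L
  ... | no v∉L = c′ , agree , proper′
    where
    neighbours : List V
    neighbours = filter (adj? v) vertices
    free : ∃ λ k → All (k ≢_) (map c neighbours)
    free = free-color-list (map c neighbours) (trans (length-map c neighbours) (cubic v))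
    k : Color
    k = proj₁ free
    k-free : ∀ {w} → Adj v w → k ≢ c w
    k-free {w} v~w = All.lookup (All.map⁻ (proj₂ free)) (∈-filter⁺ (adj? v) (complete w) v~w)
    c′ : V → Color
    c′ = update c v k
    agree : Extends L c c′
    agree u∈L = update-≢ c k λ { refl → v∉L u∈L }
    proper′ : ProperOn (v ∷ L) c′
    proper′ (here refl) (here refl) v~v = contradiction v~v loopless
    proper′ (here refl) (there w∈)  v~w eq =
      k-free v~w (trans (sym (update-≡ c v k)) (trans eq (agree w∈)))
    proper′ (there u∈)  (here refl) u~v eq =
      k-free (adj-sym u~v) (trans (sym (update-≡ c v k)) (trans (sym eq) (agree u∈)))
    proper′ (there u∈)  (there w∈)  u~w eq =
      proper u∈ w∈ u~w (trans (sym (agree u∈)) (trans eq (agree w∈)))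

  greedy-coloring : ∀ {L} c ys → ProperOn L c → ∃ λ c′ → Extends L c c′ × ProperOn (ys ++ L) c′
  greedy-coloring c []       proper = c , (λ _ → refl) , proper
  greedy-coloring c (y ∷ ys) proper =
    let c₁ , agree₁ , proper₁ = greedy-coloring c ys proper
        c₂ , agree₂ , proper₂ = extend-coloring c₁ y proper₁
    in c₂ , (λ u∈L → trans (agree₂ (∈-++⁺ʳ ys u∈L)) (agree₁ u∈L)) , proper₂

  pairedColoring : PairedColoring G
  pairedColoring with maximal-matching vertices
  ... | ps , is , covers , matched , indep = record
    { color       = c
    ; proper      = proper
    ; pairs       = ps ++ zip as bs
    ; covers      = covers′
    ; bichromatic = All.++⁺ matched-distinct halves-distinct
    }
    where
    -- The matched vertices are even in number, and so are all vertices.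
    2∣∣is∣ : 2 ∣ length is
    2∣∣is∣ = ∣m+n∣m⇒∣n {m = length (flatten ps)}
      (subst (2 ∣_) (trans (sym (↭-length covers)) (length-++ (flatten ps))) 2∣∣V∣)
      (divides (length ps) (length-flatten ps))
    h : ℕ
    h = _∣_.quotient 2∣∣is∣
    as bs : List V
    as = take h is
    bs = drop h is
    ∣is∣≡h+h : length is ≡ h + h
    ∣is∣≡h+h = trans (_∣_.equality 2∣∣is∣) (solve 1 (λ n → n :* con 2 := n :+ n) refl h)
    ∣as∣≡∣bs∣ : length as ≡ length bs
    ∣as∣≡∣bs∣ = begin
      length as       ≡⟨ length-take h is ⟩
      h ℕ.⊓ length is ≡⟨ cong (h ℕ.⊓_) ∣is∣≡h+h ⟩
      h ℕ.⊓ (h + h)   ≡⟨ ℕ.m≤n⇒m⊓n≡m (ℕ.m≤m+n h h) ⟩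
      h               ≡⟨ ℕ.m+n∸n≡m h h ⟨
      h + h ℕ.∸ h     ≡⟨ cong (ℕ._∸ h) ∣is∣≡h+h ⟨
      length is ℕ.∸ h ≡⟨ length-drop h is ⟨
      length bs       ∎
      where open ≡-Reasoning
    as++bs≡is : as ++ bs ≡ is
    as++bs≡is = take++drop≡id h is
    covers′ : flatten (ps ++ zip as bs) ↭ vertices
    covers′ = begin
      flatten (ps ++ zip as bs)         ≡⟨ flatten-++ ps (zip as bs) ⟩
      flatten ps ++ flatten (zip as bs) ↭⟨ ++⁺ˡ (flatten ps) (flatten-zip as bs ∣as∣≡∣bs∣) ⟩
      flatten ps ++ (as ++ bs)          ≡⟨ cong (flatten ps ++_) as++bs≡is ⟩
      flatten ps ++ is                  ↭⟨ covers ⟩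
      vertices                          ∎
      where open PermutationReasoning
    unique-is : Unique (as ++ bs)
    unique-is = subst Unique (sym as++bs≡is)
      (++-uniqueʳ (flatten ps) (Unique-resp-↭ (↭-sym covers) unique))
    -- Only the values on `is` persist. There the colouring is vacuously proper, because `is` is
    -- independent; all other vertices are recoloured greedily.
    c₀ : V → Color
    c₀ v = if does (v ∈? as) then zero else suc zero
    greedy : ∃ λ c → Extends is c₀ c × ProperOn (vertices ++ is) c
    greedy = greedy-coloring c₀ vertices (λ u∈ v∈ u~v → contradiction u~v (indep u∈ v∈))
    c : V → Color
    c = proj₁ greedy
    c≗c₀ : Extends is c₀ c
    c≗c₀ = proj₁ (proj₂ greedy)
    proper : Proper G c
    proper {u} {v} = proj₂ (proj₂ greedy) (∈-++⁺ˡ (complete u)) (∈-++⁺ˡ (complete v))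
    c-as : ∀ {v} → v ∈ as → c v ≡ zero
    c-as {v} v∈as = trans (c≗c₀ (subst (v ∈_) as++bs≡is (∈-++⁺ˡ v∈as)))
      (cong (if_then zero else suc zero) (dec-true (v ∈? as) v∈as))
    c-bs : ∀ {v} → v ∈ bs → c v ≡ suc zero
    c-bs {v} v∈bs = trans (c≗c₀ (subst (v ∈_) as++bs≡is (∈-++⁺ʳ as v∈bs)))
      (cong (if_then zero else suc zero)
        (dec-false (v ∈? as) λ v∈as → ++-disjoint as unique-is v∈as v∈bs))
    Distinct : V × V → Set
    Distinct (u , v) = c u ≢ c v
    matched-distinct : All Distinct ps
    matched-distinct = All.map (λ {(u , v)} → proper {u} {v}) matched
    halves-distinct : All Distinct (zip as bs)
    halves-distinct = All.map
      (λ (ca , cb) eq → contradiction (trans (sym ca) (trans eq cb)) λ ())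
      (All-zip (All.tabulate c-as) (All.tabulate c-bs))

-- Palettes for the copies and balancing along the pairs.

record Palette (x : Color) : Set where
  field
    α β γ : Color
    α≢x   : α ≢ x
    β≢x   : β ≢ x
    γ≢x   : γ ≢ x
    α≢γ   : α ≢ γ
    β≢γ   : β ≢ γ

-- The number of vertices of colour i in a vertex of colour x together with its copy of H, when
-- one side of H is coloured α (p vertices) and β (one vertex) and the other γ (p + 1 vertices).
load : ℕ → ∀ {x} → Palette x → Color → ℕ
load p {x} τ i = δ x i + (δ β i + δ γ i + p * (δ α i + δ γ i))
  where open Palette τ

-- Regroup the two loads: each of the p rungs uses α, γ, α′, γ′, hence every colour once, and what
-- remains, together with a and b, uses every colour twice.
complete-pair : ∀ p x y a b → x ≢ y → a ≢ b → ∃₂ λ (τ : Palette x) (τ′ : Palette y) →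
                ∀ i → load p τ i + load p τ′ i + (δ a i + δ b i) ≡ p + 2
complete-pair p x y a b x≢y a≢b with palette-pair x y a b x≢y a≢b
... | α , γ , α′ , γ′ , (α≢x , γ≢x , α′≢y , γ′≢y , α≢γ , α′≢γ′) , all-colors ,
      β , β′ , (β≢x , β≢γ , β′≢y , β′≢γ′) , extra = τ , τ′ , total
  where
  τ : Palette x
  τ = record { α = α ; β = β ; γ = γ ; α≢x = α≢x ; β≢x = β≢x ; γ≢x = γ≢x ; α≢γ = α≢γ ; β≢γ = β≢γ }
  τ′ : Palette y
  τ′ = record { α = α′ ; β = β′ ; γ = γ′ ; α≢x = α′≢y ; β≢x = β′≢y ; γ≢x = γ′≢y
              ; α≢γ = α′≢γ′ ; β≢γ = β′≢γ′ }
  total : ∀ i → load p τ i + load p τ′ i + (δ a i + δ b i) ≡ p + 2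
  total i = trans
    (solve 10 (λ p x β γ α y β′ γ′ α′ e →
        (x :+ (β :+ γ :+ p :* (α :+ γ))) :+ (y :+ (β′ :+ γ′ :+ p :* (α′ :+ γ′))) :+ e
        := p :* (α :+ γ :+ (α′ :+ γ′)) :+ ((x :+ β :+ γ) :+ (y :+ β′ :+ γ′) :+ e))
      refl p (δ x i) (δ β i) (δ γ i) (δ α i) (δ y i) (δ β′ i) (δ γ′ i) (δ α′ i) (δ a i + δ b i))
    (cong₂ _+_ (trans (cong (p *_) (all-colors i)) (ℕ.*-identityʳ p)) (extra i))

-- A default value, overwritten at every paired vertex; the other arguments are arbitrary distinct
-- colours.
some-palette : ∀ x → Palette x
some-palette zero    = proj₁ (complete-pair 0 zero (suc zero) zero (suc zero) (λ ()) (λ ()))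
some-palette (suc x) = proj₁ (complete-pair 0 (suc x) zero zero (suc zero) (λ ()) (λ ()))

-- After any number of pairs 2 ∣ Σ sizes, so equal sizes and two classes larger by one are the
-- only balanced states.
data Surplus : Set where
  none : Surplus
  two  : (a b : Color) → a ≢ b → Surplus

surplus : Surplus → Color → ℕ
surplus none        i = 0
surplus (two a b _) i = δ a i + δ b i

surplus≤1 : ∀ e i → surplus e i ≤ 1
surplus≤1 none          i = z≤n
surplus≤1 (two a b a≢b) i with a ≟ i | b ≟ i
... | yes refl | yes refl = contradiction refl a≢b
... | yes _    | no _     = s≤s z≤n
... | no _     | yes _    = s≤s z≤n
... | no _     | no _     = z≤n

-- A surplus of two colours is absorbed by prescribing exactly these two. From a level state,
-- prescribing the complement of {x, y} leaves x and y as the new surplus.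
next-pair : ∀ p x y → x ≢ y → ∀ e → ∃₂ λ (τ : Palette x) (τ′ : Palette y) → ∃₂ λ q e′ →
            ∀ i → load p τ i + load p τ′ i + surplus e i ≡ q + surplus e′ i
next-pair p x y x≢y (two a b a≢b) =
  let τ , τ′ , total = complete-pair p x y a b x≢y a≢b
  in τ , τ′ , p + 2 , none , λ i → trans (total i) (sym (ℕ.+-identityʳ (p + 2)))
next-pair p x y x≢y none = τ , τ′ , p + 1 , two x y x≢y , total
  where
  complement : ∃₂ λ z w → z ≢ w × (∀ i → δ x i + δ y i + (δ z i + δ w i) ≡ 1)
  complement = complementary-pair x y x≢y
  z w : Color
  z = proj₁ complement
  w = proj₁ (proj₂ complement)
  z≢w : z ≢ w
  z≢w = proj₁ (proj₂ (proj₂ complement))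
  all-colors : ∀ i → δ x i + δ y i + (δ z i + δ w i) ≡ 1
  all-colors = proj₂ (proj₂ (proj₂ complement))
  completion : ∃₂ λ (τ : Palette x) (τ′ : Palette y) →
               ∀ i → load p τ i + load p τ′ i + (δ z i + δ w i) ≡ p + 2
  completion = complete-pair p x y z w x≢y z≢w
  τ : Palette x
  τ = proj₁ completion
  τ′ : Palette y
  τ′ = proj₁ (proj₂ completion)
  total : ∀ i → load p τ i + load p τ′ i + 0 ≡ p + 1 + (δ x i + δ y i)
  -- The terms for z and w are added to both sides and cancelled: p + 2 is p + 1 plus one, and this
  -- one counts the occurrence of i among x, y, z, w.
  total i = ℕ.+-cancelʳ-≡ (δ z i + δ w i) _ _ (begin
    load p τ i + load p τ′ i + 0 + (δ z i + δ w i)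
      ≡⟨ cong (_+ (δ z i + δ w i)) (ℕ.+-identityʳ (load p τ i + load p τ′ i)) ⟩
    load p τ i + load p τ′ i + (δ z i + δ w i)      ≡⟨ proj₂ (proj₂ completion) i ⟩
    p + 2                                           ≡⟨ ℕ.+-assoc p 1 1 ⟨
    p + 1 + 1                                       ≡⟨ cong (p + 1 +_) (all-colors i) ⟨
    p + 1 + (δ x i + δ y i + (δ z i + δ w i))       ≡⟨ ℕ.+-assoc (p + 1) (δ x i + δ y i) _ ⟨
    p + 1 + (δ x i + δ y i) + (δ z i + δ w i)       ∎)
    where open ≡-Reasoning

module _ {V : Set} (_≟ⱽ_ : DecidableEquality V) (c : V → Color) (p : ℕ) where
  open Update _≟ⱽ_ {λ v → Palette (c v)}

  -- Induction on the pairs: the head pair is chosen in response to the surplus left by the tail.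
  -- Since the paired vertices are distinct, updating at u and v does not disturb the tail sum.
  balanced-palettes : ∀ ps → Unique (flatten ps) → All (λ (u , v) → c u ≢ c v) ps →
    ∃ λ (t : ∀ v → Palette (c v)) → ∃₂ λ q e →
    ∀ i → ∑ (flatten ps) (λ v → load p (t v) i) ≡ q + surplus e i
  balanced-palettes []             _ _ = (λ v → some-palette (c v)) , 0 , none , λ _ → refl
  balanced-palettes ((u , v) ∷ ps) ((u≢v ∷ u∉) ∷ v∉ ∷ unique) (cu≢cv ∷ bichromatic) =
    extend (balanced-palettes ps unique bichromatic)
    where
    extend : (∃ λ (t : ∀ v → Palette (c v)) → ∃₂ λ q e →
               ∀ i → ∑ (flatten ps) (λ v → load p (t v) i) ≡ q + surplus e i) →
             ∃ λ (t : ∀ v → Palette (c v)) → ∃₂ λ q e →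
               ∀ i → ∑ (u ∷ v ∷ flatten ps) (λ v → load p (t v) i) ≡ q + surplus e i
    extend (t , q , e , total) =
      let τ , τ′ , q′ , e′ , total′ = next-pair p (c u) (c v) cu≢cv e
          t₁ = update t u τ
          t₂ = update t₁ v τ′
          t₂u : t₂ u ≡ τ
          t₂u = trans (update-≢ t₁ τ′ (≢-sym u≢v)) (update-≡ t u τ)
          t₂w : ∀ {w} → w ∈ flatten ps → t₂ w ≡ t w
          t₂w w∈ = trans (update-≢ t₁ τ′ (All.lookup v∉ w∈)) (update-≢ t τ (All.lookup u∉ w∈))
          open ≡-Reasoning
      in t₂ , q + q′ , e′ , λ i → begin
        load p (t₂ u) i + (load p (t₂ v) i + ∑ (flatten ps) (λ w → load p (t₂ w) i))
          ≡⟨ cong₂ _+_ (cong (λ σ → load p σ i) t₂u)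
               (cong₂ _+_ (cong (λ σ → load p σ i) (update-≡ t₁ v τ′))
                 (trans (∑-cong (flatten ps) (λ w∈ → cong (λ σ → load p σ i) (t₂w w∈)))
                        (total i))) ⟩
        load p τ i + (load p τ′ i + (q + surplus e i))
          ≡⟨ solve 4 (λ a b q e → a :+ (b :+ (q :+ e)) := q :+ (a :+ b :+ e)) refl
               (load p τ i) (load p τ′ i) q (surplus e i) ⟩
        q + (load p τ i + load p τ′ i + surplus e i)   ≡⟨ cong (q +_) (total′ i) ⟩
        q + (q′ + surplus e′ i)                        ≡⟨ ℕ.+-assoc q q′ _ ⟨
        q + q′ + surplus e′ i                          ∎

-- Painting one copy of a bipartite cubic graph.

two-valued : ∀ {a b c : Fin 2} → a ≢ c → b ≢ c → a ≡ b
two-valued {zero}     {zero}     _ _ = refl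
two-valued {suc zero} {suc zero} _ _ = refl
two-valued {zero}     {suc zero} {zero}     a≢c _   = contradiction refl a≢c
two-valued {zero}     {suc zero} {suc zero} _   b≢c = contradiction refl b≢c
two-valued {suc zero} {zero}     {zero}     _   b≢c = contradiction refl b≢c
two-valued {suc zero} {zero}     {suc zero} a≢c _   = contradiction refl a≢c

module BipartiteCubicGraph (H : Graph) (x₀ : Graph.V H) (cubic : Cubic H)
                           (side : Graph.V H → Fin 2) (side-proper : Proper H side) where
  open Graph H renaming (_≟_ to _≟ⱽ_)
  open CubicGraph H cubic using (Independent; bipartition-balanced)

  near? : ∀ v → Dec (side v ≡ side x₀)
  near? v = side v ≟ side x₀

  near far : List V
  near = filter near? vertices
  far  = filter (¬? ∘ near?) vertices

  near-independent : Independent near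
  near-independent u∈ v∈ u~v = side-proper u~v
    (trans (proj₂ (∈-filter⁻ near? {xs = vertices} u∈))
           (sym (proj₂ (∈-filter⁻ near? {xs = vertices} v∈))))

  far-independent : Independent far
  far-independent u∈ v∈ u~v = side-proper u~v
    (two-valued (proj₂ (∈-filter⁻ (¬? ∘ near?) {xs = vertices} u∈))
                (proj₂ (∈-filter⁻ (¬? ∘ near?) {xs = vertices} v∈)))

  -- The pair of x₀ and `y₀` is kept apart because x₀ alone receives β. Rungs run between the two
  -- sides but need not be edges.
  record Rungs : Set where
    field
      y₀      : V
      rungs   : List (V × V)
      covers  : flatten ((x₀ , y₀) ∷ rungs) ↭ vertices
      y₀-far  : side y₀ ≢ side x₀
      crosses : All (λ (a , b) → (side a ≡ side x₀ × x₀ ≢ a) × side b ≢ side x₀) rungs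

  zip-sides : ∀ {as bs} → near ↭ x₀ ∷ as → far ≡ bs → Rungs
  -- An empty far side is impossible: the sides have equal size and the near one contains x₀.
  zip-sides {as} {[]} near↭ far≡ = contradiction
    (trans (sym (↭-length near↭))
      (trans (bipartition-balanced (filter-split near? vertices) near-independent far-independent)
             (cong length far≡)))
    λ ()
  zip-sides {as} {b ∷ bs} near↭ far≡ = record
    { y₀      = b
    ; rungs   = zip as bs
    ; covers  = begin
        flatten (zip (x₀ ∷ as) (b ∷ bs)) ↭⟨ flatten-zip (x₀ ∷ as) (b ∷ bs) lengths ⟩
        (x₀ ∷ as) ++ (b ∷ bs)            ↭⟨ ++⁺ (↭-sym near↭) (↭-reflexive (sym far≡)) ⟩
        near ++ far                      ↭⟨ filter-split near? vertices ⟩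
        vertices                         ∎
    ; y₀-far  = All.head far-all
    ; crosses = All-zip (All.zip (All.tail near-all , x₀∉as)) (All.tail far-all)
    }
    where
    open PermutationReasoning
    lengths : length (x₀ ∷ as) ≡ length (b ∷ bs)
    lengths = trans (sym (↭-length near↭))
      (trans (bipartition-balanced (filter-split near? vertices) near-independent far-independent)
             (cong length far≡))
    near-all : All (λ a → side a ≡ side x₀) (x₀ ∷ as)
    near-all = All.tabulate λ a∈ →
      proj₂ (∈-filter⁻ near? {xs = vertices} (∈-resp-↭ (↭-sym near↭) a∈))
    far-all : All (λ v → side v ≢ side x₀) (b ∷ bs)
    far-all = All.tabulate λ {v} v∈ →
      proj₂ (∈-filter⁻ (¬? ∘ near?) {xs = vertices} (subst (v ∈_) (sym far≡) v∈))
    x₀∉as : All (x₀ ≢_) as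
    x₀∉as = AllPairs.head (Unique-resp-↭ near↭ (Unique.filter⁺ near? unique))

  rungs-exist : Rungs
  rungs-exist = zip-sides (proj₂ (∈⇒↭ (∈-filter⁺ near? (complete x₀) refl))) refl

  open Rungs rungs-exist public

  module _ {x : Color} (τ : Palette x) where
    open Palette τ

    paint : V → Color
    paint v = if does (near? v) then (if does (x₀ ≟ⱽ v) then β else α) else γ

    paint-x₀ : paint x₀ ≡ β
    paint-x₀ rewrite dec-true (near? x₀) refl | dec-true (x₀ ≟ⱽ x₀) refl = refl

    paint-near : ∀ {v} → side v ≡ side x₀ → x₀ ≢ v → paint v ≡ α
    paint-near {v} v-near x₀≢v
      rewrite dec-true (near? v) v-near | dec-false (x₀ ≟ⱽ v) x₀≢v = refl

    paint-far : ∀ {v} → side v ≢ side x₀ → paint v ≡ γ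
    paint-far {v} v-far rewrite dec-false (near? v) v-far = refl

    -- γ differs from both α and β, so adjacency is irrelevant here; the same fact serves the edges
    -- of H and the rungs.
    paint-bichromatic : ∀ {u v} → side u ≡ side x₀ → side v ≢ side x₀ → paint u ≢ paint v
    paint-bichromatic {u} u-near v-far eq = decided (x₀ ≟ⱽ u) (trans eq (paint-far v-far))
      where
      decided : Dec (x₀ ≡ u) → paint u ≢ γ
      decided (yes refl) eq = β≢γ (trans (sym paint-x₀) eq)
      decided (no x₀≢u)  eq = α≢γ (trans (sym (paint-near u-near x₀≢u)) eq)

    paint-proper : Proper H paint
    paint-proper {u} {v} u~v = decided (near? u) (near? v)
      where
      decided : Dec (side u ≡ side x₀) → Dec (side v ≡ side x₀) → paint u ≢ paint v
      decided (yes u-near) (yes v-near) =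
        contradiction (trans u-near (sym v-near)) (side-proper u~v)
      decided (yes u-near) (no v-far)   = paint-bichromatic u-near v-far
      decided (no u-far)   (yes v-near) = ≢-sym (paint-bichromatic v-near u-far)
      decided (no u-far)   (no v-far)   = contradiction (two-valued u-far v-far) (side-proper u~v)

    paint-avoids : ∀ v → paint v ≢ x
    paint-avoids v with does (near? v) | does (x₀ ≟ⱽ v)
    ... | true  | true  = β≢x
    ... | true  | false = α≢x
    ... | false | _     = γ≢x

    -- The pair of x₀ and `y₀` contributes β and γ, every rung α and γ. Adding the vertex to which
    -- the copy is attached gives `load`.
    ∑-paint : ∀ i → ∑ vertices (λ v → δ (paint v) i)
                    ≡ δ β i + δ γ i + length rungs * (δ α i + δ γ i)
    ∑-paint i = begin
      ∑ vertices f
        ≡⟨ ∑-↭ covers f ⟨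
      f x₀ + (f y₀ + ∑ (flatten rungs) f)
        ≡⟨ ℕ.+-assoc (f x₀) (f y₀) _ ⟨
      f x₀ + f y₀ + ∑ (flatten rungs) f
        ≡⟨ cong₂ _+_ (cong₂ (λ a b → δ a i + δ b i) paint-x₀ (paint-far y₀-far))
             (∑-flatten (All.map (λ ((a-near , x₀≢a) , b-far) →
               cong₂ (λ a b → δ a i + δ b i) (paint-near a-near x₀≢a) (paint-far b-far))
               crosses)) ⟩
      δ β i + δ γ i + length rungs * (δ α i + δ γ i) ∎
      where
      open ≡-Reasoning
      f : V → ℕ
      f v = δ (paint v) i

-- The corona step.

near-equal : ∀ q {e e′} → e ≤ 1 → e′ ≤ 1 → ∣ q + e - (q + e′) ∣ ≤ 1
near-equal q {e} {e′} e≤1 e′≤1 rewrite ℕ.∣m+n-m+o∣≡∣n-o∣ q e e′ =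
  ℕ.≤-trans (ℕ.∣m-n∣≤m⊔n e e′) (ℕ.⊔-lub e≤1 e′≤1)

module CoronaStep (F H : Graph) (F-colored : PairedColoring F) (x₀ : Graph.V H) (cubic : Cubic H)
                  (side : Graph.V H → Fin 2) (side-proper : Proper H side) where
  private
    module F = Graph F
    module H = Graph H
  open Corona F H
  open PairedColoring F-colored using (pairs) renaming
    (color to c; proper to c-proper; covers to F-covers; bichromatic to c-bichromatic)
  open BipartiteCubicGraph H x₀ cubic side side-proper

  p : ℕ
  p = length rungs

  palettes : ∃ λ (t : ∀ v → Palette (c v)) → ∃₂ λ q e →
             ∀ i → ∑ (flatten pairs) (λ v → load p (t v) i) ≡ q + surplus e i
  palettes = balanced-palettes F._≟_ c p pairs
    (Unique-resp-↭ (↭-sym F-covers) F.unique) c-bichromatic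

  t : ∀ v → Palette (c v)
  t = proj₁ palettes

  q : ℕ
  q = proj₁ (proj₂ palettes)

  e : Surplus
  e = proj₁ (proj₂ (proj₂ palettes))

  total : ∀ i → ∑ (flatten pairs) (λ v → load p (t v) i) ≡ q + surplus e i
  total = proj₂ (proj₂ (proj₂ palettes))

  color : CV → Color
  color (inj₁ u)       = c u
  color (inj₂ (u , x)) = paint (t u) x

  color-proper : Proper corona color
  color-proper (base a)        = c-proper a
  color-proper (copy {u} a)    = paint-proper (t u) a
  color-proper (joinˡ {u} {x}) = ≢-sym (paint-avoids (t u) x)
  color-proper (joinʳ {u} {x}) = paint-avoids (t u) x

  copied : List ((F.V × H.V) × (F.V × H.V))
  copied = copy-pairs F.vertices ((x₀ , y₀) ∷ rungs)

  both : {A B : Set} → (A → B) → A × A → B × B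
  both f (a , b) = f a , f b

  Bichromatic : CV × CV → Set
  Bichromatic (u , v) = color u ≢ color v

  pairedColoring : PairedColoring corona
  pairedColoring = record
    { color       = color
    ; proper      = λ {u} {v} → color-proper {u} {v}
    ; pairs       = map (both inj₁) pairs ++ map (both inj₂) copied
    ; covers      = begin
        flatten (map (both inj₁) pairs ++ map (both inj₂) copied)
          ≡⟨ flatten-++ (map (both inj₁) pairs) (map (both inj₂) copied) ⟩
        flatten (map (both inj₁) pairs) ++ flatten (map (both inj₂) copied)
          ≡⟨ cong₂ _++_ (flatten-map inj₁ pairs) (flatten-map inj₂ copied) ⟩
        map inj₁ (flatten pairs) ++ map inj₂ (flatten copied)
          ↭⟨ ++⁺ (map⁺ inj₁ F-covers) (map⁺ inj₂ copied-covers) ⟩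
        map inj₁ F.vertices ++ map inj₂ (cartesianProduct F.vertices H.vertices) ∎
    ; bichromatic = All.++⁺ (All.map⁺ c-bichromatic) (All.map⁺ copied-bichromatic)
    }
    where
    open PermutationReasoning
    copied-covers : flatten copied ↭ cartesianProduct F.vertices H.vertices
    copied-covers = ↭-trans (↭-reflexive (flatten-copy-pairs F.vertices _))
                            (cartesianProduct-↭ʳ F.vertices covers)
    copied-bichromatic : All (λ pr → Bichromatic (both inj₂ pr)) copied
    copied-bichromatic = All-copy-pairs F.vertices
      ((λ u → paint-bichromatic (t u) refl y₀-far) ∷
       All.map (λ ((a-near , _) , b-far) u → paint-bichromatic (t u) a-near b-far) crosses)

  -- Grouping each vertex of F with its own copy of H turns the class size into a sum of loads,
  -- which the pairing reorders.
  classSize-color : ∀ i → classSize corona color i ≡ q + surplus e i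
  classSize-color i = begin
    classSize corona color i
      ≡⟨ length-filter-∑ (λ v → color v ≟ i) cvertices ⟩
    ∑ cvertices f
      ≡⟨ ∑-++ (map inj₁ F.vertices) _ f ⟩
    ∑ (map inj₁ F.vertices) f + ∑ (map inj₂ (cartesianProduct F.vertices H.vertices)) f
      ≡⟨ cong₂ _+_ (∑-map inj₁ f F.vertices)
           (trans (∑-map inj₂ f (cartesianProduct F.vertices H.vertices))
                  (∑-cartesianProduct (f ∘ inj₂) F.vertices H.vertices)) ⟩
    ∑ F.vertices (λ u → δ (c u) i) + ∑ F.vertices (λ u → ∑ H.vertices (λ x → δ (paint (t u) x) i))
      ≡⟨ ∑-+ F.vertices (λ u → δ (c u) i) _ ⟨
    ∑ F.vertices (λ u → δ (c u) i + ∑ H.vertices (λ x → δ (paint (t u) x) i))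
      ≡⟨ ∑-cong F.vertices (λ {u} _ → cong (δ (c u) i +_) (∑-paint (t u) i)) ⟩
    ∑ F.vertices (λ u → load p (t u) i)
      ≡⟨ ∑-↭ F-covers (λ u → load p (t u) i) ⟨
    ∑ (flatten pairs) (λ u → load p (t u) i)
      ≡⟨ total i ⟩
    q + surplus e i ∎
    where
    open ≡-Reasoning
    f : CV → ℕ
    f v = δ (color v) i

  equitable : EquitablyColorable corona 4
  equitable = color , (λ {u} {v} → color-proper {u} {v}) , λ i j →
    subst (_≤ 1) (sym (cong₂ ∣_-_∣ (classSize-color i) (classSize-color j)))
      (near-equal q (surplus≤1 e i) (surplus≤1 e j))

-- Deciding equitable colourability

-- Search upwards from 0; if `P 0` fails, the shifted predicate is searched with a smaller bound.
least : (P : ℕ → Set) → (∀ k → Dec (P k)) → ∀ n → P n → ∃ λ k → IsLeast P k × k ≤ n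
least P P? zero    Pn = 0 , (Pn , λ _ _ → z≤n) , z≤n
least P P? (suc n) Pn with P? 0
... | yes P0 = 0 , (P0 , λ _ _ → z≤n) , z≤n
... | no ¬P0 =
  let k , (Pk , minimal) , k≤n = least (P ∘ suc) (P? ∘ suc) n Pn
  in suc k ,
     (Pk , λ { zero P0 → contradiction P0 ¬P0 ; (suc j) Pj → s≤s (minimal j Pj) }) ,
     s≤s k≤n

module _ (F : Graph) {k : ℕ} where
  open Graph F hiding (_≟_)

  decode : (Fin (length vertices) → Fin k) → V → Fin k
  decode f v = f (Any.index (complete v))

  decode-surjective : ∀ c v → c v ≡ decode (finToFun (funToFin (c ∘ lookup vertices))) v
  decode-surjective c v = trans (cong c (lookup-index (complete v)))
    (sym (finToFun-funToFin (c ∘ lookup vertices) (Any.index (complete v))))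

  -- Colourings are coded as numbers through the positions in `vertices`, so only finitely many
  -- candidates arise. Decoding recovers a colouring only pointwise, hence P must respect pointwise
  -- equality.
  any-function? : (P : (V → Fin k) → Set) → (∀ c → Dec (P c)) →
                  (∀ {c c′} → (∀ v → c v ≡ c′ v) → P c → P c′) → Dec (∃ P)
  any-function? P P? P-resp = map′ (λ (j , Pj) → decode (finToFun j) , Pj)
    (λ (c , Pc) → funToFin (c ∘ lookup vertices) , P-resp (decode-surjective c) Pc)
    (any? (λ j → P? (decode (finToFun j))))

  proper? : (c : V → Fin k) → Dec (Proper F c)
  proper? c = map′
    (λ all {u} {v} → All.lookup (All.lookup all (complete u)) (complete v))
    (λ proper → All.tabulate λ {u} _ → All.tabulate λ {v} _ → proper {u} {v})
    (All.all? (λ u → All.all? (λ v → adj? u v →-dec ¬? (c u ≟ c v)) vertices) vertices)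

  classSize-cong : ∀ {c c′ : V → Fin k} → (∀ v → c v ≡ c′ v) → ∀ i →
                   classSize F c i ≡ classSize F c′ i
  classSize-cong {c} {c′} c≗c′ i = begin
    classSize F c i                   ≡⟨ length-filter-∑ (λ v → c v ≟ i) vertices ⟩
    ∑ vertices (λ v → 𝟙 (c v ≟ i))    ≡⟨ ∑-cong vertices (λ {v} _ →
                                           cong (λ a → 𝟙 (a ≟ i)) (c≗c′ v)) ⟩
    ∑ vertices (λ v → 𝟙 (c′ v ≟ i))   ≡⟨ length-filter-∑ (λ v → c′ v ≟ i) vertices ⟨
    classSize F c′ i                  ∎
    where open ≡-Reasoning

equitablyColorable? : ∀ F k → Dec (EquitablyColorable F k)
equitablyColorable? F k = any-function? F _
  (λ c → proper? F c ×-dec all? λ i → all? λ j → ∣ classSize F c i - classSize F c j ∣ ℕ.≤? 1)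
  (λ c≗c′ (proper , equitable) →
    (λ {u} {v} u~v eq → proper u~v (trans (c≗c′ u) (trans eq (sym (c≗c′ v))))) ,
    λ i j → subst (_≤ 1)
      (cong₂ ∣_-_∣ (classSize-cong F c≗c′ i) (classSize-cong F c≗c′ j)) (equitable i j))

-- Iterating the corona.

corona-pairedColoring : (G H : Graph) → Cubic G → Q₂ H → ∀ l → PairedColoring (G ⊚^[ l ] H)
corona-pairedColoring G H cubicG Q₂H zero = CubicGraph.pairedColoring G cubicG
corona-pairedColoring G H cubicG Q₂H@((x₀ , _) , cubicH , (side , side-proper) , _) (suc l) =
  CoronaStep.pairedColoring (G ⊚^[ l ] H) H (corona-pairedColoring G H cubicG Q₂H l)
    x₀ cubicH side side-proper

theorem3p3 : (G H : Graph) → Connected G → Cubic G → Q₂ H →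
    (l : ℕ) → 1 ≤ l →
    ∃ λ k → IsEquitableChromaticNumber (G ⊚^[ l ] H) k × k ≤ 4
theorem3p3 G H _ cubicG Q₂H@((x₀ , _) , cubicH , (side , side-proper) , _) (suc l) _ =
  -- The last corona is coloured equitably from a paired colouring of the preceding stage, which is
  -- G itself when the exponent is 1.
  least (EquitablyColorable (G ⊚^[ suc l ] H)) (equitablyColorable? (G ⊚^[ suc l ] H)) 4
    (CoronaStep.equitable (G ⊚^[ l ] H) H (corona-pairedColoring G H cubicG Q₂H l)
      x₀ cubicH side side-proper)
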